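{- Let $S,T$ be as in the context and let $\mathrm{Pr}_T(x)$ be any $\Sigma_1$ provability predicate of $T$. Then: 1. If $\mathrm{Pr}_T(x)$ satisfies $\mathbf{E}$, $\mathbf{C}$ and $\mathbf{D3}$, then $T\nvdash\mathrm{Con}^{\mathrm{L}}_T$. 2. If $\mathrm{Pr}_T(x)$ satisfies $\mathbf{C}$ and $\mathbf{\Sigma_1C}^-$, then $\mathrm{Pr}_T(x)$ does not satisfy $\mathbf{Ros}$.
   Context: $\mathcal{L}_A=\{0,\mathsf{s},+,\times,\leq\}$ is the language of first-order arithmetic, and "formula" means $\mathcal{L}_A$-formula; $\ulcorner\varphi\urcorner$ is the numeral of the Gödel number of $\varphi$. $\Sigma_1$ formulas are those of the form $\exists\vec{x}\,\delta$ with $\delta$ a $\Delta_0$ formula. $S$ and $T$ are consistent c.e. extensions of Peano Arithmetic $\mathsf{PA}$ in the language $\mathcal{L}_A$ such that $T$ is stronger than $S$ (every theorem of $S$ is a theorem of $T$; $S=T$ is allowed). A formula $\mathrm{Pr}_T(x)$ is a provability predicate of $T$ if for every formula $\varphi$: $T\vdash\varphi$ if and only if $S\vdash\mathrm{Pr}_T(\ulcorner\varphi\urcorner)$. A $\Sigma_1$ provability predicate is one that is a $\Sigma_1$ formula. $\mathrm{Con}^{\mathrm{L}}_T :\equiv \neg\,\mathrm{Pr}_T(\ulcorner 0=1\urcorner)$. Conditions on $\mathrm{Pr}_T(x)$: - $\mathbf{E}$: for all formulas $\varphi,\psi$, if $T\vdash\varphi\leftrightarrow\psi$, then $S\vdash\mathrm{Pr}_T(\ulcorner\varphi\urcorner)\leftrightarrow\mathrm{Pr}_T(\ulcorner\psi\urcorner)$.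 - $\mathbf{C}$: $S\vdash\mathrm{Pr}_T(\ulcorner\varphi\urcorner)\land\mathrm{Pr}_T(\ulcorner\psi\urcorner)\to\mathrm{Pr}_T(\ulcorner\varphi\land\psi\urcorner)$ for all formulas $\varphi,\psi$. - $\mathbf{D3}$: $S\vdash\mathrm{Pr}_T(\ulcorner\varphi\urcorner)\to\mathrm{Pr}_T(\ulcorner\mathrm{Pr}_T(\ulcorner\varphi\urcorner)\urcorner)$ for every formula $\varphi$. - $\mathbf{\Sigma_1C}^-$: there is a finite subtheory $T_0$ of $T$ (a finite set of sentences that are theorems of $T$) such that for every $\Sigma_1$ sentence $\varphi$, $S\vdash\varphi\to\mathrm{Pr}_T(\ulcorner\bigwedge T_0\to\varphi\urcorner)$; by convention $\bigwedge\emptyset$ is $0=0$. - $\mathbf{Ros}$: for every formula $\varphi$, if $T\vdash\neg\varphi$, then $T\vdash\neg\,\mathrm{Pr}_T(\ulcorner\varphi\urcorner)$. -}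

module Defs where

open import Data.Nat using (ℕ; zero; suc; _+_; _*_; _<_)
open import Data.Nat.Properties
open import Data.Fin using (Fin; zero; suc; toℕ)
open import Data.Fin.Properties using (toℕ-injective)
open import Data.Vec using (Vec; []; _∷_; lookup)
open import Data.List using (List; []; _∷_; map)
open import Data.List.Membership.Propositional using (_∈_)
open import Data.List.Relation.Unary.All using (All)
open import Data.Product using (Σ; ∃-syntax; _×_; _,_)
open import Data.Empty using (⊥-elim)
open import Function.Bundles using (_⇔_)
open import Relation.Nullary using (¬_)
open import Relation.Binary using (tri<; tri≈; tri>)
open import Relation.Binary.PropositionalEquality using (_≡_; refl; sym; trans; cong; cong₂)

infixl 7 _⊗_
infixl 6 _⊕_
infix  5 _≐_ _≼_
infixr 4 _∧̇_
infixr 3 _∨̇_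
infixr 2 _⇒_
infix  1 _⇔̇_

-- Well-scoped de Bruijn syntax: the free variables of an element of
-- Tm n or Fm n are among v₀ , … , vₙ₋₁.
data Tm (n : ℕ) : Set where
  var     : Fin n → Tm n
  𝟎       : Tm n
  𝐬       : Tm n → Tm n
  _⊕_ _⊗_ : Tm n → Tm n → Tm n

data Fm (n : ℕ) : Set where
  ⊥̇              : Fm n
  _≐_ _≼_        : Tm n → Tm n → Fm n
  _∧̇_ _∨̇_ _⇒_   : Fm n → Fm n → Fm n
  ∀̇_ ∃̇_          : Fm (suc n) → Fm n

Sentence : Set
Sentence = Fm 0

¬̇_ : ∀ {n} → Fm n → Fm n
¬̇ φ = φ ⇒ ⊥̇

_⇔̇_ : ∀ {n} → Fm n → Fm n → Fm n
φ ⇔̇ ψ = (φ ⇒ ψ) ∧̇ (ψ ⇒ φ)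

num : ∀ {n} → ℕ → Tm n
num zero    = 𝟎
num (suc k) = 𝐬 (num k)

renTm : ∀ {m n} → (Fin m → Fin n) → Tm m → Tm n
renTm ρ (var i) = var (ρ i)
renTm ρ 𝟎       = 𝟎
renTm ρ (𝐬 t)   = 𝐬 (renTm ρ t)
renTm ρ (t ⊕ u) = renTm ρ t ⊕ renTm ρ u
renTm ρ (t ⊗ u) = renTm ρ t ⊗ renTm ρ u

liftRen : ∀ {m n} → (Fin m → Fin n) → Fin (suc m) → Fin (suc n)
liftRen ρ zero    = zero
liftRen ρ (suc i) = suc (ρ i)

ren : ∀ {m n} → (Fin m → Fin n) → Fm m → Fm n
ren ρ ⊥̇       = ⊥̇
ren ρ (t ≐ u) = renTm ρ t ≐ renTm ρ u
ren ρ (t ≼ u) = renTm ρ t ≼ renTm ρ u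
ren ρ (φ ∧̇ ψ) = ren ρ φ ∧̇ ren ρ ψ
ren ρ (φ ∨̇ ψ) = ren ρ φ ∨̇ ren ρ ψ
ren ρ (φ ⇒ ψ) = ren ρ φ ⇒ ren ρ ψ
ren ρ (∀̇ φ)   = ∀̇ ren (liftRen ρ) φ
ren ρ (∃̇ φ)   = ∃̇ ren (liftRen ρ) φ

wkTm : ∀ {n} → Tm n → Tm (suc n)
wkTm = renTm suc

wk : ∀ {n} → Fm n → Fm (suc n)
wk = ren suc

embed : ∀ {n} → Sentence → Fm n
embed = ren (λ ())

subTm : ∀ {m n} → (Fin m → Tm n) → Tm m → Tm n
subTm σ (var i) = σ i
subTm σ 𝟎       = 𝟎
subTm σ (𝐬 t)   = 𝐬 (subTm σ t)
subTm σ (t ⊕ u) = subTm σ t ⊕ subTm σ u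
subTm σ (t ⊗ u) = subTm σ t ⊗ subTm σ u

liftSub : ∀ {m n} → (Fin m → Tm n) → Fin (suc m) → Tm (suc n)
liftSub σ zero    = var zero
liftSub σ (suc i) = wkTm (σ i)

sub : ∀ {m n} → (Fin m → Tm n) → Fm m → Fm n
sub σ ⊥̇       = ⊥̇
sub σ (t ≐ u) = subTm σ t ≐ subTm σ u
sub σ (t ≼ u) = subTm σ t ≼ subTm σ u
sub σ (φ ∧̇ ψ) = sub σ φ ∧̇ sub σ ψ
sub σ (φ ∨̇ ψ) = sub σ φ ∨̇ sub σ ψ
sub σ (φ ⇒ ψ) = sub σ φ ⇒ sub σ ψ
sub σ (∀̇ φ)   = ∀̇ sub (liftSub σ) φ
sub σ (∃̇ φ)   = ∃̇ sub (liftSub σ) φ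

inst : ∀ {n} → Tm n → Fin (suc n) → Tm n
inst t zero    = t
inst t (suc i) = var i

_[_] : ∀ {n} → Fm (suc n) → Tm n → Fm n
φ [ t ] = sub (inst t) φ

-- φ(s x), where x is the last-bound variable
succSub : ∀ {n} → Fin (suc n) → Tm (suc n)
succSub zero    = 𝐬 (var zero)
succSub (suc i) = var (suc i)

data Δ₀ {n : ℕ} : Fm n → Set where
  bot  : Δ₀ ⊥̇
  eq   : ∀ t u → Δ₀ (t ≐ u)
  leq  : ∀ t u → Δ₀ (t ≼ u)
  and  : ∀ {φ ψ} → Δ₀ φ → Δ₀ ψ → Δ₀ (φ ∧̇ ψ)
  or   : ∀ {φ ψ} → Δ₀ φ → Δ₀ ψ → Δ₀ (φ ∨̇ ψ)
  imp  : ∀ {φ ψ} → Δ₀ φ → Δ₀ ψ → Δ₀ (φ ⇒ ψ)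
  ball : ∀ (t : Tm n) {φ} → Δ₀ φ → Δ₀ (∀̇ ((var zero ≼ wkTm t) ⇒ φ))
  bex  : ∀ (t : Tm n) {φ} → Δ₀ φ → Δ₀ (∃̇ ((var zero ≼ wkTm t) ∧̇ φ))

data Σ₁ {n : ℕ} : Fm n → Set where
  delta : ∀ {φ} → Δ₀ φ → Σ₁ φ
  ex    : ∀ {φ} → Σ₁ φ → Σ₁ (∃̇ φ)

-- A theory is given by its set of axioms; T ∣ Γ ⊢ φ below is classical natural
-- deduction with equality, the variables of Γ and φ being held fixed.
Theory : Set₁
Theory = Sentence → Set

infix 0 _∣_⊢_ _⊢_ _⊑_

data _∣_⊢_ (T : Theory) {n : ℕ} (Γ : List (Fm n)) : Fm n → Set where
  ax  : ∀ {σ} → T σ → T ∣ Γ ⊢ embed σ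
  hyp : ∀ {φ} → φ ∈ Γ → T ∣ Γ ⊢ φ
  ⊥E  : ∀ {φ} → T ∣ Γ ⊢ ⊥̇ → T ∣ Γ ⊢ φ
  dne : ∀ {φ} → T ∣ Γ ⊢ ¬̇ ¬̇ φ → T ∣ Γ ⊢ φ
  ∧I  : ∀ {φ ψ} → T ∣ Γ ⊢ φ → T ∣ Γ ⊢ ψ → T ∣ Γ ⊢ φ ∧̇ ψ
  ∧E₁ : ∀ {φ ψ} → T ∣ Γ ⊢ φ ∧̇ ψ → T ∣ Γ ⊢ φ
  ∧E₂ : ∀ {φ ψ} → T ∣ Γ ⊢ φ ∧̇ ψ → T ∣ Γ ⊢ ψ
  ∨I₁ : ∀ {φ ψ} → T ∣ Γ ⊢ φ → T ∣ Γ ⊢ φ ∨̇ ψ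
  ∨I₂ : ∀ {φ ψ} → T ∣ Γ ⊢ ψ → T ∣ Γ ⊢ φ ∨̇ ψ
  ∨E  : ∀ {φ ψ χ} → T ∣ Γ ⊢ φ ∨̇ ψ → T ∣ φ ∷ Γ ⊢ χ → T ∣ ψ ∷ Γ ⊢ χ → T ∣ Γ ⊢ χ
  ⇒I  : ∀ {φ ψ} → T ∣ φ ∷ Γ ⊢ ψ → T ∣ Γ ⊢ φ ⇒ ψ
  ⇒E  : ∀ {φ ψ} → T ∣ Γ ⊢ φ ⇒ ψ → T ∣ Γ ⊢ φ → T ∣ Γ ⊢ ψ
  ∀I  : ∀ {φ} → T ∣ map wk Γ ⊢ φ → T ∣ Γ ⊢ ∀̇ φ
  ∀E  : ∀ {φ} t → T ∣ Γ ⊢ ∀̇ φ → T ∣ Γ ⊢ φ [ t ]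
  ∃I  : ∀ {φ} t → T ∣ Γ ⊢ φ [ t ] → T ∣ Γ ⊢ ∃̇ φ
  ∃E  : ∀ {φ ψ} → T ∣ Γ ⊢ ∃̇ φ → T ∣ φ ∷ map wk Γ ⊢ wk ψ → T ∣ Γ ⊢ ψ
  ≐I  : ∀ t → T ∣ Γ ⊢ t ≐ t
  ≐E  : ∀ φ {t u} → T ∣ Γ ⊢ t ≐ u → T ∣ Γ ⊢ φ [ t ] → T ∣ Γ ⊢ φ [ u ]

_⊢_ : ∀ {n} → Theory → Fm n → Set
T ⊢ φ = T ∣ [] ⊢ φ

_⊑_ : Theory → Theory → Set
S ⊑ T = ∀ {n} (φ : Fm n) → S ⊢ φ → T ⊢ φ

Consistent : Theory → Set
Consistent T = ¬ (T ⊢ ⊥̇ {0})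

closure : ∀ {n} → Fm n → Sentence
closure {zero}  φ = φ
closure {suc n} φ = closure (∀̇ φ)

private
  x₀ : ∀ {n} → Tm (suc n)
  x₀ = var zero

  x₁ : ∀ {n} → Tm (suc (suc n))
  x₁ = var (suc zero)

  x₂ : ∀ {n} → Tm (suc (suc (suc n)))
  x₂ = var (suc (suc zero))

data PA : Theory where
  s≢0   : PA (∀̇ ¬̇ (𝐬 x₀ ≐ 𝟎))
  s-inj : PA (∀̇ ∀̇ (𝐬 x₁ ≐ 𝐬 x₀ ⇒ x₁ ≐ x₀))
  +-0   : PA (∀̇ (x₀ ⊕ 𝟎 ≐ x₀))
  +-s   : PA (∀̇ ∀̇ (x₁ ⊕ 𝐬 x₀ ≐ 𝐬 (x₁ ⊕ x₀)))
  *-0   : PA (∀̇ (x₀ ⊗ 𝟎 ≐ 𝟎))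
  *-s   : PA (∀̇ ∀̇ (x₁ ⊗ 𝐬 x₀ ≐ x₁ ⊗ x₀ ⊕ x₁))
  ≤-def : PA (∀̇ ∀̇ (x₁ ≼ x₀ ⇔̇ ∃̇ (x₀ ⊕ x₂ ≐ x₁)))
  ind   : ∀ {n} (φ : Fm (suc n)) →
          PA (closure (φ [ 𝟎 ] ∧̇ (∀̇ (φ ⇒ sub succSub φ)) ⇒ ∀̇ φ))

-- Shoenfield's injective pairing polynomial.
pair : ℕ → ℕ → ℕ
pair a b = (a + b) * (a + b) + a

-- Every term is uniquely of the form s(…s(u)…) with u not a successor.  Its
-- code is the pair of the number of leading successors and the code of u, so
-- that numerals have codes polynomial in their value.
succs : ∀ {n} → Tm n → ℕ
succs (𝐬 t) = suc (succs t)
succs _     = 0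

mutual
  core : ∀ {n} → Tm n → ℕ
  core 𝟎       = pair 0 0
  core (var i) = pair 1 (toℕ i)
  core (t ⊕ u) = pair 2 (pair (gnTm t) (gnTm u))
  core (t ⊗ u) = pair 3 (pair (gnTm t) (gnTm u))
  core (𝐬 t)   = core t

  gnTm : ∀ {n} → Tm n → ℕ
  gnTm t = pair (succs t) (core t)

gn : ∀ {n} → Fm n → ℕ
gn ⊥̇       = pair 0 0
gn (t ≐ u) = pair 1 (pair (gnTm t) (gnTm u))
gn (t ≼ u) = pair 2 (pair (gnTm t) (gnTm u))
gn (φ ∧̇ ψ) = pair 3 (pair (gn φ) (gn ψ))
gn (φ ∨̇ ψ) = pair 4 (pair (gn φ) (gn ψ))
gn (φ ⇒ ψ) = pair 5 (pair (gn φ) (gn ψ))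
gn (∀̇ φ)   = pair 6 (gn φ)
gn (∃̇ φ)   = pair 7 (gn φ)

⌜_⌝ : ∀ {m n} → Fm n → Tm m
⌜ φ ⌝ = num (gn φ)

private
  pair-< : ∀ a b c d → a + b < c + d → pair a b < pair c d
  pair-< a b c d lt = begin-strict
    (a + b) * (a + b) + a            ≤⟨ +-monoʳ-≤ ((a + b) * (a + b)) (m≤m+n a b) ⟩
    (a + b) * (a + b) + (a + b)      ≡⟨ +-comm ((a + b) * (a + b)) (a + b) ⟩
    suc (a + b) * (a + b)            <⟨ *-monoʳ-< (suc (a + b)) (n<1+n (a + b)) ⟩
    suc (a + b) * suc (a + b)        ≤⟨ *-mono-≤ lt lt ⟩
    (c + d) * (c + d)                ≤⟨ m≤m+n _ c ⟩
    (c + d) * (c + d) + c            ∎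
    where open ≤-Reasoning

pair-injective : ∀ a b c d → pair a b ≡ pair c d → a ≡ c × b ≡ d
pair-injective a b c d e with <-cmp (a + b) (c + d)
... | tri< lt _ _ = ⊥-elim (<-irrefl e (pair-< a b c d lt))
... | tri> _ _ gt = ⊥-elim (<-irrefl (sym e) (pair-< c d a b gt))
... | tri≈ _ p _  = a≡c , +-cancelˡ-≡ a b d (trans p (cong (_+ d) (sym a≡c)))
  where
  a≡c : a ≡ c
  a≡c = +-cancelˡ-≡ ((a + b) * (a + b)) a c (trans e (cong (λ k → k * k + c) (sym p)))

private
  shape : ∀ {n} → Tm n → ℕ
  shape 𝟎       = 0
  shape (var i) = 1
  shape (t ⊕ u) = 2
  shape (t ⊗ u) = 3
  shape (𝐬 t)   = shape t

  body : ∀ {n} → Tm n → ℕ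
  body 𝟎       = 0
  body (var i) = toℕ i
  body (t ⊕ u) = pair (gnTm t) (gnTm u)
  body (t ⊗ u) = pair (gnTm t) (gnTm u)
  body (𝐬 t)   = body t

  core≡ : ∀ {n} (t : Tm n) → core t ≡ pair (shape t) (body t)
  core≡ 𝟎       = refl
  core≡ (var i) = refl
  core≡ (t ⊕ u) = refl
  core≡ (t ⊗ u) = refl
  core≡ (𝐬 t)   = core≡ t

  fmShape : ∀ {n} → Fm n → ℕ
  fmShape ⊥̇       = 0
  fmShape (t ≐ u) = 1
  fmShape (t ≼ u) = 2
  fmShape (φ ∧̇ ψ) = 3
  fmShape (φ ∨̇ ψ) = 4
  fmShape (φ ⇒ ψ) = 5
  fmShape (∀̇ φ)   = 6
  fmShape (∃̇ φ)   = 7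

  fmBody : ∀ {n} → Fm n → ℕ
  fmBody ⊥̇       = 0
  fmBody (t ≐ u) = pair (gnTm t) (gnTm u)
  fmBody (t ≼ u) = pair (gnTm t) (gnTm u)
  fmBody (φ ∧̇ ψ) = pair (gn φ) (gn ψ)
  fmBody (φ ∨̇ ψ) = pair (gn φ) (gn ψ)
  fmBody (φ ⇒ ψ) = pair (gn φ) (gn ψ)
  fmBody (∀̇ φ)   = gn φ
  fmBody (∃̇ φ)   = gn φ

  gn≡ : ∀ {n} (φ : Fm n) → gn φ ≡ pair (fmShape φ) (fmBody φ)
  gn≡ ⊥̇       = refl
  gn≡ (t ≐ u) = refl
  gn≡ (t ≼ u) = refl
  gn≡ (φ ∧̇ ψ) = refl
  gn≡ (φ ∨̇ ψ) = refl
  gn≡ (φ ⇒ ψ) = refl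
  gn≡ (∀̇ φ)   = refl
  gn≡ (∃̇ φ)   = refl

mutual
  private
    tm-inj : ∀ {n} (t u : Tm n) → succs t ≡ succs u → shape t ≡ shape u → body t ≡ body u → t ≡ u
    tm-inj 𝟎       𝟎         p refl e = refl
    tm-inj (var i) (var j)   p refl e = cong var (toℕ-injective e)
    tm-inj (t ⊕ u) (t′ ⊕ u′) p refl e with pair-injective (gnTm t) (gnTm u) (gnTm t′) (gnTm u′) e
    ... | e₁ , e₂ = cong₂ _⊕_ (gnTm-injective t t′ e₁) (gnTm-injective u u′ e₂)
    tm-inj (t ⊗ u) (t′ ⊗ u′) p refl e with pair-injective (gnTm t) (gnTm u) (gnTm t′) (gnTm u′) e
    ... | e₁ , e₂ = cong₂ _⊗_ (gnTm-injective t t′ e₁) (gnTm-injective u u′ e₂)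
    tm-inj (𝐬 t)   (𝐬 u)     p q    e = cong 𝐬 (tm-inj t u (suc-injective p) q e)

  gnTm-injective : ∀ {n} (t u : Tm n) → gnTm t ≡ gnTm u → t ≡ u
  gnTm-injective t u e with pair-injective (succs t) (core t) (succs u) (core u) e
  ... | p , c with pair-injective (shape t) (body t) (shape u) (body u)
                     (trans (sym (core≡ t)) (trans c (core≡ u)))
  ... | q , b = tm-inj t u p q b

mutual
  private
    fm-inj : ∀ {n} (φ ψ : Fm n) → fmShape φ ≡ fmShape ψ → fmBody φ ≡ fmBody ψ → φ ≡ ψ
    fm-inj ⊥̇       ⊥̇         refl e = refl
    fm-inj (t ≐ u) (t′ ≐ u′) refl e with pair-injective (gnTm t) (gnTm u) (gnTm t′) (gnTm u′) e
    ... | e₁ , e₂ = cong₂ _≐_ (gnTm-injective t t′ e₁) (gnTm-injective u u′ e₂)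
    fm-inj (t ≼ u) (t′ ≼ u′) refl e with pair-injective (gnTm t) (gnTm u) (gnTm t′) (gnTm u′) e
    ... | e₁ , e₂ = cong₂ _≼_ (gnTm-injective t t′ e₁) (gnTm-injective u u′ e₂)
    fm-inj (φ ∧̇ ψ) (φ′ ∧̇ ψ′) refl e with pair-injective (gn φ) (gn ψ) (gn φ′) (gn ψ′) e
    ... | e₁ , e₂ = cong₂ _∧̇_ (gn-injective φ φ′ e₁) (gn-injective ψ ψ′ e₂)
    fm-inj (φ ∨̇ ψ) (φ′ ∨̇ ψ′) refl e with pair-injective (gn φ) (gn ψ) (gn φ′) (gn ψ′) e
    ... | e₁ , e₂ = cong₂ _∨̇_ (gn-injective φ φ′ e₁) (gn-injective ψ ψ′ e₂)
    fm-inj (φ ⇒ ψ) (φ′ ⇒ ψ′) refl e with pair-injective (gn φ) (gn ψ) (gn φ′) (gn ψ′) e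
    ... | e₁ , e₂ = cong₂ _⇒_ (gn-injective φ φ′ e₁) (gn-injective ψ ψ′ e₂)
    fm-inj (∀̇ φ)   (∀̇ φ′)    refl e = cong ∀̇_ (gn-injective φ φ′ e)
    fm-inj (∃̇ φ)   (∃̇ φ′)    refl e = cong ∃̇_ (gn-injective φ φ′ e)

  gn-injective : ∀ {n} (φ ψ : Fm n) → gn φ ≡ gn ψ → φ ≡ ψ
  gn-injective φ ψ e with pair-injective (fmShape φ) (fmBody φ) (fmShape ψ) (fmBody ψ)
                            (trans (sym (gn≡ φ)) (trans e (gn≡ ψ)))
  ... | q , b = fm-inj φ ψ q b

-- Codes of partial (μ-)recursive functions.
data Rec : ℕ → Set where
  zer  : Rec 0
  succ : Rec 1
  proj : ∀ {n} → Fin n → Rec n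
  comp : ∀ {m n} → Rec m → Vec (Rec n) m → Rec n
  prec : ∀ {n} → Rec n → Rec (suc (suc n)) → Rec (suc n)
  mu   : ∀ {n} → Rec (suc n) → Rec n

infix 4 _⟨_⟩↓_ _⟨_⟩↓*_

-- f ⟨ xs ⟩↓ y : the function coded by f is defined at xs, with value y.
mutual
  data _⟨_⟩↓_ : ∀ {n} → Rec n → Vec ℕ n → ℕ → Set where
    ↓zer   : zer ⟨ [] ⟩↓ 0
    ↓succ  : ∀ {x} → succ ⟨ x ∷ [] ⟩↓ suc x
    ↓proj  : ∀ {n} {i : Fin n} {xs} → proj i ⟨ xs ⟩↓ lookup xs i
    ↓comp  : ∀ {m n} {f : Rec m} {gs : Vec (Rec n) m} {xs ys z} →
             gs ⟨ xs ⟩↓* ys → f ⟨ ys ⟩↓ z → comp f gs ⟨ xs ⟩↓ z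
    ↓prec0 : ∀ {n} {f : Rec n} {g xs y} →
             f ⟨ xs ⟩↓ y → prec f g ⟨ 0 ∷ xs ⟩↓ y
    ↓precS : ∀ {n} {f : Rec n} {g k xs y z} →
             prec f g ⟨ k ∷ xs ⟩↓ y → g ⟨ k ∷ y ∷ xs ⟩↓ z → prec f g ⟨ suc k ∷ xs ⟩↓ z
    ↓mu    : ∀ {n} {f : Rec (suc n)} {xs y} →
             f ⟨ y ∷ xs ⟩↓ 0 → (∀ k → k < y → ∃[ v ] f ⟨ k ∷ xs ⟩↓ suc v) → mu f ⟨ xs ⟩↓ y

  data _⟨_⟩↓*_ {n : ℕ} : ∀ {m} → Vec (Rec n) m → Vec ℕ n → Vec ℕ m → Set where
    []  : ∀ {xs} → [] ⟨ xs ⟩↓* []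
    _∷_ : ∀ {m} {g : Rec n} {gs : Vec (Rec n) m} {xs y ys} →
          g ⟨ xs ⟩↓ y → gs ⟨ xs ⟩↓* ys → (g ∷ gs) ⟨ xs ⟩↓* (y ∷ ys)

CE : (ℕ → Set) → Set
CE P = Σ (Rec 1) λ f → ∀ k → P k ⇔ (∃[ y ] f ⟨ k ∷ [] ⟩↓ y)

CETheory : Theory → Set
CETheory T = CE (λ k → Σ Sentence λ φ → T φ × gn φ ≡ k)

-- "For every formula" includes formulas with free variables; Pr [ ⌜ φ ⌝ ] is
-- always a sentence.

IsProvabilityPredicate : Theory → Theory → Fm 1 → Set
IsProvabilityPredicate S T Pr =
  ∀ {n} (φ : Fm n) → (T ⊢ φ) ⇔ (S ⊢ Pr [ ⌜ φ ⌝ ])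

ConL : Fm 1 → Sentence
ConL Pr = ¬̇ (Pr [ ⌜ 𝟎 {0} ≐ 𝐬 𝟎 ⌝ ])

CondE : Theory → Theory → Fm 1 → Set
CondE S T Pr = ∀ {n} (φ ψ : Fm n) →
  T ⊢ φ ⇔̇ ψ → S ⊢ Pr [ ⌜ φ ⌝ ] ⇔̇ Pr [ ⌜ ψ ⌝ ]

CondC : Theory → Fm 1 → Set
CondC S Pr = ∀ {n} (φ ψ : Fm n) →
  S ⊢ Pr [ ⌜ φ ⌝ ] ∧̇ Pr [ ⌜ ψ ⌝ ] ⇒ Pr [ ⌜ φ ∧̇ ψ ⌝ ]

CondD3 : Theory → Fm 1 → Set
CondD3 S Pr = ∀ {n} (φ : Fm n) →
  S ⊢ Pr [ ⌜ φ ⌝ ] ⇒ Pr [ ⌜ Pr [ ⌜ φ ⌝ ] ⌝ ]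

⋀ : List Sentence → Sentence
⋀ []           = 𝟎 ≐ 𝟎
⋀ (φ ∷ [])     = φ
⋀ (φ ∷ ψ ∷ ψs) = φ ∧̇ ⋀ (ψ ∷ ψs)

CondΣ₁C⁻ : Theory → Theory → Fm 1 → Set
CondΣ₁C⁻ S T Pr = Σ (List Sentence) λ T₀ → All (T ⊢_) T₀ ×
  ((φ : Sentence) → Σ₁ φ → S ⊢ φ ⇒ Pr [ ⌜ ⋀ T₀ ⇒ φ ⌝ ])

CondRos : Theory → Fm 1 → Set
CondRos T Pr = ∀ {n} (φ : Fm n) → T ⊢ ¬̇ φ → T ⊢ ¬̇ (Pr [ ⌜ φ ⌝ ])

{-# OPTIONS --safe #-}

-- Idea.  Numerals have polynomial codes, so the code of "∃x (x = k ∧ φ(x))" is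
-- a polynomial in k = ⌜φ⌝, that is, a term of the language.  Diagonalising
-- ¬Pr(x) through this term gives θ with PA ⊢ θ ↔ ¬Pr(⌜θ⌝), and PA only has to
-- evaluate closed terms.  In both parts S proves that
-- Pr(⌜θ⌝) implies Pr(⌜χ⌝) for a sentence χ refutable in T, of the form
-- θ ∧ ¬θ, resp. θ ∧ (⋀T₀ → Pr(⌜θ⌝)).  If T also proved ¬Pr(⌜χ⌝), it would
-- prove ¬Pr(⌜θ⌝), hence θ, hence Pr(⌜θ⌝).

module Submission where

open import Defs
open import Data.Nat using (ℕ; zero; suc; _+_; _*_)
open import Data.Nat.Properties using (+-comm)
open import Data.Fin using (Fin; zero; suc)
open import Data.List using (List; []; _∷_)
open import Data.List.Relation.Unary.All using (All; []; _∷_)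
open import Data.List.Relation.Unary.Any using (here; there)
open import Data.Product using (_×_; _,_; ∃-syntax)
open import Function.Bundles using (Equivalence)
open import Relation.Nullary using (¬_)
open import Relation.Binary.PropositionalEquality using (_≡_; refl; sym; trans; cong; cong₂; subst; subst₂)

-- Substitution

subTm-ren : ∀ {l m n} (τ : Fin m → Tm n) (ρ : Fin l → Fin m) t →
  subTm τ (renTm ρ t) ≡ subTm (λ i → τ (ρ i)) t
subTm-ren τ ρ (var i) = refl
subTm-ren τ ρ 𝟎       = refl
subTm-ren τ ρ (𝐬 t)   = cong 𝐬 (subTm-ren τ ρ t)
subTm-ren τ ρ (t ⊕ u) = cong₂ _⊕_ (subTm-ren τ ρ t) (subTm-ren τ ρ u)
subTm-ren τ ρ (t ⊗ u) = cong₂ _⊗_ (subTm-ren τ ρ t) (subTm-ren τ ρ u)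

renTm-sub : ∀ {l m n} {ρ : Fin m → Fin n} {σ : Fin l → Tm m} {υ : Fin l → Tm n} →
  (∀ i → renTm ρ (σ i) ≡ υ i) → ∀ t → renTm ρ (subTm σ t) ≡ subTm υ t
renTm-sub e (var i) = e i
renTm-sub e 𝟎       = refl
renTm-sub e (𝐬 t)   = cong 𝐬 (renTm-sub e t)
renTm-sub e (t ⊕ u) = cong₂ _⊕_ (renTm-sub e t) (renTm-sub e u)
renTm-sub e (t ⊗ u) = cong₂ _⊗_ (renTm-sub e t) (renTm-sub e u)

liftSub-wkTm : ∀ {m n} (σ : Fin m → Tm n) t → subTm (liftSub σ) (wkTm t) ≡ wkTm (subTm σ t)
liftSub-wkTm σ t = trans (subTm-ren (liftSub σ) suc t) (sym (renTm-sub (λ _ → refl) t))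

subTm-sub : ∀ {l m n} {τ : Fin m → Tm n} {σ : Fin l → Tm m} {υ : Fin l → Tm n} →
  (∀ i → subTm τ (σ i) ≡ υ i) → ∀ t → subTm τ (subTm σ t) ≡ subTm υ t
subTm-sub e (var i) = e i
subTm-sub e 𝟎       = refl
subTm-sub e (𝐬 t)   = cong 𝐬 (subTm-sub e t)
subTm-sub e (t ⊕ u) = cong₂ _⊕_ (subTm-sub e t) (subTm-sub e u)
subTm-sub e (t ⊗ u) = cong₂ _⊗_ (subTm-sub e t) (subTm-sub e u)

liftSub-sub : ∀ {l m n} {τ : Fin m → Tm n} {σ : Fin l → Tm m} {υ : Fin l → Tm n} →
  (∀ i → subTm τ (σ i) ≡ υ i) → ∀ i → subTm (liftSub τ) (liftSub σ i) ≡ liftSub υ i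
liftSub-sub e zero              = refl
liftSub-sub {τ = τ} {σ} e (suc i) = trans (liftSub-wkTm τ (σ i)) (cong wkTm (e i))

-- `υ` need only agree pointwise with the composite of `σ` and `τ`. This hypothesis passes under a
-- binder by `liftSub-sub`, without any equation between functions.
sub-sub : ∀ {l m n} {τ : Fin m → Tm n} {σ : Fin l → Tm m} {υ : Fin l → Tm n} →
  (∀ i → subTm τ (σ i) ≡ υ i) → ∀ φ → sub τ (sub σ φ) ≡ sub υ φ
sub-sub e ⊥̇       = refl
sub-sub e (t ≐ u) = cong₂ _≐_ (subTm-sub e t) (subTm-sub e u)
sub-sub e (t ≼ u) = cong₂ _≼_ (subTm-sub e t) (subTm-sub e u)
sub-sub e (φ ∧̇ ψ) = cong₂ _∧̇_ (sub-sub e φ) (sub-sub e ψ)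
sub-sub e (φ ∨̇ ψ) = cong₂ _∨̇_ (sub-sub e φ) (sub-sub e ψ)
sub-sub e (φ ⇒ ψ) = cong₂ _⇒_ (sub-sub e φ) (sub-sub e ψ)
sub-sub e (∀̇ φ)   = cong ∀̇_ (sub-sub (liftSub-sub e) φ)
sub-sub e (∃̇ φ)   = cong ∃̇_ (sub-sub (liftSub-sub e) φ)

liftSub-ren : ∀ {l m n} {ρ : Fin m → Fin n} {σ : Fin l → Tm m} {υ : Fin l → Tm n} →
  (∀ i → renTm ρ (σ i) ≡ υ i) → ∀ i → renTm (liftRen ρ) (liftSub σ i) ≡ liftSub υ i
liftSub-ren e zero              = refl
liftSub-ren {ρ = ρ} {σ} e (suc i) = trans (renTm-wkTm (σ i)) (cong wkTm (e i))
  where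
  renTm-wkTm : ∀ t → renTm (liftRen ρ) (wkTm t) ≡ wkTm (renTm ρ t)
  renTm-wkTm (var i) = refl
  renTm-wkTm 𝟎       = refl
  renTm-wkTm (𝐬 t)   = cong 𝐬 (renTm-wkTm t)
  renTm-wkTm (t ⊕ u) = cong₂ _⊕_ (renTm-wkTm t) (renTm-wkTm u)
  renTm-wkTm (t ⊗ u) = cong₂ _⊗_ (renTm-wkTm t) (renTm-wkTm u)

ren-sub : ∀ {l m n} {ρ : Fin m → Fin n} {σ : Fin l → Tm m} {υ : Fin l → Tm n} →
  (∀ i → renTm ρ (σ i) ≡ υ i) → ∀ φ → ren ρ (sub σ φ) ≡ sub υ φ
ren-sub e ⊥̇       = refl
ren-sub e (t ≐ u) = cong₂ _≐_ (renTm-sub e t) (renTm-sub e u)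
ren-sub e (t ≼ u) = cong₂ _≼_ (renTm-sub e t) (renTm-sub e u)
ren-sub e (φ ∧̇ ψ) = cong₂ _∧̇_ (ren-sub e φ) (ren-sub e ψ)
ren-sub e (φ ∨̇ ψ) = cong₂ _∨̇_ (ren-sub e φ) (ren-sub e ψ)
ren-sub e (φ ⇒ ψ) = cong₂ _⇒_ (ren-sub e φ) (ren-sub e ψ)
ren-sub e (∀̇ φ)   = cong ∀̇_ (ren-sub (liftSub-ren e) φ)
ren-sub e (∃̇ φ)   = cong ∃̇_ (ren-sub (liftSub-ren e) φ)

subTm-var : ∀ {n} (t : Tm n) → subTm var t ≡ t
subTm-var (var i) = refl
subTm-var 𝟎       = refl
subTm-var (𝐬 t)   = cong 𝐬 (subTm-var t)
subTm-var (t ⊕ u) = cong₂ _⊕_ (subTm-var t) (subTm-var u)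
subTm-var (t ⊗ u) = cong₂ _⊗_ (subTm-var t) (subTm-var u)

inst-wkTm : ∀ {n} (u t : Tm n) → subTm (inst u) (wkTm t) ≡ t
inst-wkTm u t = trans (subTm-ren (inst u) suc t) (subTm-var t)

subTm-num : ∀ {m n} (σ : Fin m → Tm n) k → subTm σ (num k) ≡ num k
subTm-num σ zero    = refl
subTm-num σ (suc k) = cong 𝐬 (subTm-num σ k)

renTm-num : ∀ {m n} (ρ : Fin m → Fin n) k → renTm ρ (num k) ≡ num k
renTm-num ρ zero    = refl
renTm-num ρ (suc k) = cong 𝐬 (renTm-num ρ k)

Δ₀-sub : ∀ {m n} (σ : Fin m → Tm n) {φ} → Δ₀ φ → Δ₀ (sub σ φ)
Δ₀-sub σ bot        = bot
Δ₀-sub σ (eq t u)   = eq _ _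
Δ₀-sub σ (leq t u)  = leq _ _
Δ₀-sub σ (and d e)  = and (Δ₀-sub σ d) (Δ₀-sub σ e)
Δ₀-sub σ (or d e)   = or (Δ₀-sub σ d) (Δ₀-sub σ e)
Δ₀-sub σ (imp d e)  = imp (Δ₀-sub σ d) (Δ₀-sub σ e)
-- `ball` asks for a bound of the form `wkTm`; the rewrite exhibits the substituted bound as
-- `wkTm (subTm σ t)`.
Δ₀-sub σ (ball t d) rewrite liftSub-wkTm σ t = ball (subTm σ t) (Δ₀-sub (liftSub σ) d)
Δ₀-sub σ (bex t d)  rewrite liftSub-wkTm σ t = bex (subTm σ t) (Δ₀-sub (liftSub σ) d)

-- Makes the sentence Pr(⌜θ⌝) an admissible instance of Σ₁-completeness.
Σ₁-sub : ∀ {m n} (σ : Fin m → Tm n) {φ} → Σ₁ φ → Σ₁ (sub σ φ)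
Σ₁-sub σ (delta d) = delta (Δ₀-sub σ d)
Σ₁-sub σ (ex s)    = ex (Σ₁-sub (liftSub σ) s)

infix 8 _⟦_⟧
-- For `φ` with one variable, `φ [ t ]` forces `t` to be closed. Here `t` may be open, as
-- `diagTm (var zero)` is.
_⟦_⟧ : ∀ {n} → Fm 1 → Tm n → Fm n
φ ⟦ t ⟧ = sub (λ _ → t) φ

⟦⟧-inst : ∀ {n} (φ : Fm 1) (t : Tm n) (u : Tm (suc n)) → (φ ⟦ u ⟧) [ t ] ≡ φ ⟦ subTm (inst t) u ⟧
⟦⟧-inst φ t u = sub-sub (λ _ → refl) φ

⟦⟧≡[] : (φ : Fm 1) (t : Tm 0) → φ ⟦ t ⟧ ≡ φ [ t ]
⟦⟧≡[] φ t = trans (sym (⟦⟧-inst φ t (var zero))) (sub-sub (λ { zero → refl }) φ)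

-- Equality and evaluation of closed terms

module _ {U : Theory} {n : ℕ} {Γ : List (Fm n)} where

  -- `var zero` is the hole of the context `c`. Replacing `t` by `u` in the formula "`c[t]` equals
  -- `c`", whose left side is held fixed, turns reflexivity into the claim.
  ≐-cong : ∀ (c : Tm (suc n)) {t u} → U ∣ Γ ⊢ t ≐ u → U ∣ Γ ⊢ subTm (inst t) c ≐ subTm (inst u) c
  ≐-cong c {t} {u} p =
    subst (λ s → U ∣ Γ ⊢ s ≐ subTm (inst u) c) (inst-wkTm u c[t])
      (≐E (wkTm c[t] ≐ c) p
        (subst (λ s → U ∣ Γ ⊢ s ≐ c[t]) (sym (inst-wkTm t c[t])) (≐I c[t])))
    where
    c[t] = subTm (inst t) c

  ≐-sym : ∀ {t u} → U ∣ Γ ⊢ t ≐ u → U ∣ Γ ⊢ u ≐ t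
  ≐-sym {t} {u} p =
    subst (λ s → U ∣ Γ ⊢ u ≐ s) (inst-wkTm u t)
      (≐E (var zero ≐ wkTm t) p (subst (λ s → U ∣ Γ ⊢ t ≐ s) (sym (inst-wkTm t t)) (≐I t)))

  ≐-trans : ∀ {t u v} → U ∣ Γ ⊢ t ≐ u → U ∣ Γ ⊢ u ≐ v → U ∣ Γ ⊢ t ≐ v
  ≐-trans {t} {u} {v} p q =
    subst (λ s → U ∣ Γ ⊢ s ≐ v) (inst-wkTm v t)
      (≐E (wkTm t ≐ var zero) q (subst (λ s → U ∣ Γ ⊢ s ≐ u) (sym (inst-wkTm u t)) p))

  𝐬-cong : ∀ {t u} → U ∣ Γ ⊢ t ≐ u → U ∣ Γ ⊢ 𝐬 t ≐ 𝐬 u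
  𝐬-cong = ≐-cong (𝐬 (var zero))

  ⊕-cong : ∀ {t t′ u u′} → U ∣ Γ ⊢ t ≐ t′ → U ∣ Γ ⊢ u ≐ u′ → U ∣ Γ ⊢ t ⊕ u ≐ t′ ⊕ u′
  ⊕-cong {t} {t′} {u} {u′} p q = ≐-trans
    (subst₂ (λ a b → U ∣ Γ ⊢ t ⊕ a ≐ t′ ⊕ b) (inst-wkTm t u) (inst-wkTm t′ u)
      (≐-cong (var zero ⊕ wkTm u) p))
    (subst₂ (λ a b → U ∣ Γ ⊢ a ⊕ u ≐ b ⊕ u′) (inst-wkTm u t′) (inst-wkTm u′ t′)
      (≐-cong (wkTm t′ ⊕ var zero) q))

  ⊗-cong : ∀ {t t′ u u′} → U ∣ Γ ⊢ t ≐ t′ → U ∣ Γ ⊢ u ≐ u′ → U ∣ Γ ⊢ t ⊗ u ≐ t′ ⊗ u′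
  ⊗-cong {t} {t′} {u} {u′} p q = ≐-trans
    (subst₂ (λ a b → U ∣ Γ ⊢ t ⊗ a ≐ t′ ⊗ b) (inst-wkTm t u) (inst-wkTm t′ u)
      (≐-cong (var zero ⊗ wkTm u) p))
    (subst₂ (λ a b → U ∣ Γ ⊢ a ⊗ u ≐ b ⊗ u′) (inst-wkTm u t′) (inst-wkTm u′ t′)
      (≐-cong (wkTm t′ ⊗ var zero) q))

  ⟦⟧-resp-≐ : ∀ (φ : Fm 1) {t u} → U ∣ Γ ⊢ t ≐ u → U ∣ Γ ⊢ φ ⟦ t ⟧ → U ∣ Γ ⊢ φ ⟦ u ⟧
  ⟦⟧-resp-≐ φ {t} {u} p q =
    subst (U ∣ Γ ⊢_) (⟦⟧-inst φ u (var zero))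
      (≐E (φ ⟦ var zero ⟧) p (subst (U ∣ Γ ⊢_) (sym (⟦⟧-inst φ t (var zero))) q))

pairTm : ∀ {n} → Tm n → Tm n → Tm n
pairTm t u = (t ⊕ u) ⊗ (t ⊕ u) ⊕ t

module _ {n : ℕ} {Γ : List (Fm n)} where

  ⊕-zero : ∀ t → PA ∣ Γ ⊢ t ⊕ 𝟎 ≐ t
  ⊕-zero t = ∀E t (ax +-0)

  ⊕-suc : ∀ t u → PA ∣ Γ ⊢ t ⊕ 𝐬 u ≐ 𝐬 (t ⊕ u)
  ⊕-suc t u = subst (λ a → PA ∣ Γ ⊢ a ⊕ 𝐬 u ≐ 𝐬 (a ⊕ u)) (inst-wkTm u t) (∀E u (∀E t (ax +-s)))

  ⊗-zero : ∀ t → PA ∣ Γ ⊢ t ⊗ 𝟎 ≐ 𝟎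
  ⊗-zero t = ∀E t (ax *-0)

  ⊗-suc : ∀ t u → PA ∣ Γ ⊢ t ⊗ 𝐬 u ≐ t ⊗ u ⊕ t
  ⊗-suc t u = subst (λ a → PA ∣ Γ ⊢ a ⊗ 𝐬 u ≐ a ⊗ u ⊕ a) (inst-wkTm u t) (∀E u (∀E t (ax *-s)))

  -- PA recurses on the second summand and `_+_` on the first; with the order `b + a` the two
  -- recursions run in step.
  ⊕-num : ∀ a b → PA ∣ Γ ⊢ num a ⊕ num b ≐ num (b + a)
  ⊕-num a zero    = ⊕-zero (num a)
  ⊕-num a (suc b) = ≐-trans (⊕-suc (num a) (num b)) (𝐬-cong (⊕-num a b))

  ⊗-num : ∀ a b → PA ∣ Γ ⊢ num a ⊗ num b ≐ num (b * a)
  ⊗-num a zero    = ⊗-zero (num a)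
  ⊗-num a (suc b) = ≐-trans (⊗-suc (num a) (num b))
    (≐-trans (⊕-cong (⊗-num a b) (≐I (num a))) (⊕-num (b * a) a))

  ⊕-eval : ∀ {t u} a b → PA ∣ Γ ⊢ t ≐ num a → PA ∣ Γ ⊢ u ≐ num b → PA ∣ Γ ⊢ t ⊕ u ≐ num (a + b)
  ⊕-eval {t} {u} a b p q =
    subst (λ k → PA ∣ Γ ⊢ t ⊕ u ≐ num k) (+-comm b a) (≐-trans (⊕-cong p q) (⊕-num a b))

  pairTm-eval : ∀ {t u} a b → PA ∣ Γ ⊢ t ≐ num a → PA ∣ Γ ⊢ u ≐ num b →
                PA ∣ Γ ⊢ pairTm t u ≐ num (pair a b)
  pairTm-eval a b p q = ⊕-eval ((a + b) * (a + b)) a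
    (≐-trans (⊗-cong p+q p+q) (⊗-num (a + b) (a + b))) p
    where p+q = ⊕-eval a b p q

-- The diagonal lemma

-- Equivalent to φ(k), but with no substitution into `φ`, so that its code is built from `k` and the
-- code of `φ` by pairing alone.
numeralInstance : ℕ → Fm 1 → Sentence
numeralInstance k φ = ∃̇ (var zero ≐ num k ∧̇ φ)

-- The tags 7, 3 and 1 are those of `∃̇`, `∧̇` and `≐`. `pair 0 (pair 1 0)` codes `var zero`,
-- `pair k 0` codes `num k`, and the last `k` stands for the code of the formula itself.
diag : ℕ → ℕ
diag k = pair 7 (pair 3 (pair (pair 1 (pair (pair 0 (pair 1 0)) (pair k 0))) k))

diagTm : ∀ {n} → Tm n → Tm n
diagTm t = pairTm (num 7) (pairTm (num 3)
  (pairTm (pairTm (num 1) (pairTm (num (pair 0 (pair 1 0))) (pairTm t 𝟎))) t))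

gnTm-num : ∀ {n} k → gnTm {n} (num k) ≡ pair k 0
gnTm-num {n} k = cong₂ pair (succs-num k) (core-num k)
  where
  succs-num : ∀ k → succs {n} (num k) ≡ k
  succs-num zero    = refl
  succs-num (suc k) = cong suc (succs-num k)
  core-num : ∀ k → core {n} (num k) ≡ 0
  core-num zero    = refl
  core-num (suc k) = core-num k

gn-numeralInstance : ∀ φ → gn (numeralInstance (gn φ) φ) ≡ diag (gn φ)
gn-numeralInstance φ =
  cong (λ c → pair 7 (pair 3 (pair (pair 1 (pair (pair 0 (pair 1 0)) c)) (gn φ))))
    (gnTm-num (gn φ))

-- `t` may be open: in `fixedPoint` it is also a variable that only a hypothesis in `Γ` equates with
-- `num k`.
diagTm-eval : ∀ {n} {Γ : List (Fm n)} {t} k → PA ∣ Γ ⊢ t ≐ num k → PA ∣ Γ ⊢ diagTm t ≐ num (diag k)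
diagTm-eval k p =
  pairTm-eval 7 _ (≐I _) (pairTm-eval 3 _ (≐I _)
    (pairTm-eval _ k (pairTm-eval 1 _ (≐I _)
      (pairTm-eval (pair 0 (pair 1 0)) (pair k 0) (≐I _) (pairTm-eval k 0 p (≐I 𝟎)))) p))

diagBody : Fm 1 → Fm 1
diagBody φ = φ ⟦ diagTm (var zero) ⟧

-- Stated for variables k and θ, since for the actual fixed point the numeral
-- ⌜ θ ⌝ unfolds to an astronomically large term.
fixedPoint : ∀ φ k (θ : Sentence) → gn θ ≡ diag k →
  PA ⊢ numeralInstance k (diagBody φ) ⇔̇ φ [ ⌜ θ ⌝ ]
fixedPoint φ k θ gn-θ = ∧I (⇒I (∃E (hyp (here refl)) unfold)) (⇒I fold)
  where
  diagTm≐ : ∀ {n} {Γ : List (Fm n)} {t} → PA ∣ Γ ⊢ t ≐ num k → PA ∣ Γ ⊢ diagTm t ≐ ⌜ θ ⌝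
  diagTm≐ {Γ = Γ} {t} p = subst (λ d → PA ∣ Γ ⊢ diagTm t ≐ num d) (sym gn-θ) (diagTm-eval k p)

  unfold : ∀ {Γ} → PA ∣ (var zero ≐ num k ∧̇ diagBody φ) ∷ Γ ⊢ wk (φ [ ⌜ θ ⌝ ])
  -- Since x = k, the term `diagTm` at x equals `⌜ θ ⌝`, so `diagBody φ` at x becomes `φ` at
  -- `⌜ θ ⌝`; weakening leaves the numeral unchanged.
  unfold = subst (PA ∣ _ ⊢_) (sym (ren-sub (λ { zero → renTm-num suc (gn θ) }) φ))
    (⟦⟧-resp-≐ φ (diagTm≐ (∧E₁ (hyp (here refl)))) (∧E₂ (hyp (here refl))))

  fold : PA ∣ φ [ ⌜ θ ⌝ ] ∷ [] ⊢ numeralInstance k (diagBody φ)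
  fold = ∃I (num k) (∧I
    (subst (λ t → PA ∣ _ ⊢ num k ≐ t) (sym (subTm-num (inst (num k)) k)) (≐I (num k)))
    (subst (PA ∣ _ ⊢_) (sym (⟦⟧-inst φ (num k) (diagTm (var zero))))
      (⟦⟧-resp-≐ φ (≐-sym (diagTm≐ (≐I (num k))))
        (subst (PA ∣ φ [ ⌜ θ ⌝ ] ∷ [] ⊢_) (sym (⟦⟧≡[] φ ⌜ θ ⌝)) (hyp (here refl))))))

-- Self-reference comes from giving `diagBody φ` its own code k: the resulting instance has code
-- `diag k`, which is what `diagTm` computes inside it.
diagonalLemma : (φ : Fm 1) → ∃[ θ ] (PA ⊢ θ ⇔̇ φ [ ⌜ θ ⌝ ])
diagonalLemma φ = numeralInstance (gn (diagBody φ)) (diagBody φ) ,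
  fixedPoint φ (gn (diagBody φ)) (numeralInstance (gn (diagBody φ)) (diagBody φ))
    (gn-numeralInstance (diagBody φ))

-- Propositional reasoning

module _ {U : Theory} {n : ℕ} {Γ : List (Fm n)} {φ ψ : Fm n} where

  -- The premises are first taken as hypotheses and the result is then applied to `p` and `q`, so
  -- that neither derivation has to be moved to a larger context. The next three lemmas proceed in
  -- the same way.
  ⇒-trans : ∀ {χ} → U ∣ Γ ⊢ φ ⇒ ψ → U ∣ Γ ⊢ ψ ⇒ χ → U ∣ Γ ⊢ φ ⇒ χ
  ⇒-trans p q = ⇒E (⇒E (⇒I (⇒I (⇒I
    (⇒E (hyp (there (here refl))) (⇒E (hyp (there (there (here refl)))) (hyp (here refl))))))) p) q

  ⇒-∧ : ∀ {χ} → U ∣ Γ ⊢ φ ⇒ ψ → U ∣ Γ ⊢ φ ∧̇ ψ ⇒ χ → U ∣ Γ ⊢ φ ⇒ χ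
  ⇒-∧ p q = ⇒E (⇒E (⇒I (⇒I (⇒I
    (⇒E (hyp (there (here refl)))
      (∧I (hyp (here refl)) (⇒E (hyp (there (there (here refl)))) (hyp (here refl)))))))) p) q

  -- Brings the liar equivalence into the form Pr(⌜θ⌝) ↔ ¬θ, to which E is applied. The direction
  -- from `¬̇ φ` to `ψ` is classical.
  ⇔-¬-swap : U ∣ Γ ⊢ φ ⇔̇ ¬̇ ψ → U ∣ Γ ⊢ ψ ⇔̇ ¬̇ φ
  ⇔-¬-swap p = ⇒E (⇒I (∧I
    (⇒I (⇒I (⇒E (⇒E (∧E₁ (hyp (there (there (here refl))))) (hyp (here refl))) (hyp (there (here refl))))))
    (⇒I (dne (⇒I (⇒E (hyp (there (here refl)))
      (⇒E (∧E₂ (hyp (there (there (here refl))))) (hyp (here refl))))))))) p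

  -- The guard `α` will be ⋀T₀. As it is provable, the second conjunct yields `ψ`, while the first
  -- yields `¬̇ ψ`.
  refutes-∧-guarded : ∀ {α} → U ∣ Γ ⊢ φ ⇔̇ ¬̇ ψ → U ∣ Γ ⊢ α → U ∣ Γ ⊢ ¬̇ (φ ∧̇ (α ⇒ ψ))
  refutes-∧-guarded p q = ⇒E (⇒E (⇒I (⇒I (⇒I
    (⇒E (⇒E (∧E₁ (hyp (there (there (here refl))))) (∧E₁ (hyp (here refl))))
      (⇒E (∧E₂ (hyp (here refl))) (hyp (there (here refl)))))))) p) q

-- Both sides are refutable, the right one by `s≢0`. Through E this links the contradiction about θ
-- to the 0 = 1 of `ConL`.
∧-¬⇔0≐1 : ∀ φ → PA ⊢ φ ∧̇ ¬̇ φ ⇔̇ 𝟎 {0} ≐ 𝐬 𝟎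
∧-¬⇔0≐1 φ = ∧I
  (⇒I (⊥E (⇒E (∧E₂ (hyp (here refl))) (∧E₁ (hyp (here refl))))))
  (⇒I (⊥E (⇒E (∀E 𝟎 (ax s≢0)) (≐-sym (hyp (here refl))))))

⊢⋀ : ∀ {U φs} → All (U ⊢_) φs → U ⊢ ⋀ φs
⊢⋀ []           = ≐I 𝟎
⊢⋀ (p ∷ [])     = p
⊢⋀ (p ∷ q ∷ qs) = ∧I p (⊢⋀ (q ∷ qs))

-- The liar sentence and the two unprovability arguments

module LiarSentence
  {S T : Theory} (T-con : Consistent T) (PA⊑T : PA ⊑ T) (S⊑T : S ⊑ T)
  {Pr : Fm 1} (Pr-Σ₁ : Σ₁ Pr) (Pr-prov : IsProvabilityPredicate S T Pr)
  (θ : Sentence) (θ⇔¬□θ : T ⊢ θ ⇔̇ ¬̇ (Pr [ ⌜ θ ⌝ ]))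
  where

  □θ : Sentence
  □θ = Pr [ ⌜ θ ⌝ ]

  -- From `¬̇ □θ` the theory T gets θ; then S proves `□θ`, and T inherits this.
  T⊬¬□θ : ¬ (T ⊢ ¬̇ □θ)
  T⊬¬□θ p = T-con (⇒E p (S⊑T _ (Equivalence.to (Pr-prov θ) (⇒E (∧E₂ θ⇔¬□θ) p))))

  ConL-unprovable : CondE S T Pr → CondC S Pr → CondD3 S Pr → ¬ (T ⊢ ConL Pr)
  ConL-unprovable E C D3 con = T⊬¬□θ (⇒-trans (S⊑T _ □θ⇒□⊥) con)
    where
    □θ⇒□⊥ : S ⊢ □θ ⇒ Pr [ ⌜ 𝟎 {0} ≐ 𝐬 𝟎 ⌝ ]
    □θ⇒□⊥ = ⇒-trans
      -- D3 gives Pr(⌜Pr(⌜θ⌝)⌝), which E turns into Pr(⌜¬θ⌝); C joins this with Pr(⌜θ⌝).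
      (⇒-∧ (⇒-trans (D3 θ) (∧E₁ (E □θ (¬̇ θ) (⇔-¬-swap θ⇔¬□θ)))) (C θ (¬̇ θ)))
      (∧E₁ (E (θ ∧̇ ¬̇ θ) (𝟎 ≐ 𝐬 𝟎) (PA⊑T _ (∧-¬⇔0≐1 θ))))

  ¬Ros : CondC S Pr → CondΣ₁C⁻ S T Pr → ¬ CondRos T Pr
  ¬Ros C (T₀ , T⊢T₀ , Σ₁C) Ros = T⊬¬□θ (⇒-trans
    -- Here Σ₁-completeness for `□θ` itself takes the place of D3, at the cost of the guard ⋀T₀.
    (S⊑T _ (⇒-∧ (Σ₁C □θ (Σ₁-sub _ Pr-Σ₁)) (C θ (⋀ T₀ ⇒ □θ))))
    (Ros _ (refutes-∧-guarded θ⇔¬□θ (⊢⋀ T⊢T₀))))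

corollary2p9 : (S T : Theory) →
    CETheory S → CETheory T →
    Consistent S → Consistent T →
    PA ⊑ S → PA ⊑ T → S ⊑ T →
    (Pr : Fm 1) → Σ₁ Pr → IsProvabilityPredicate S T Pr →
    (CondE S T Pr → CondC S Pr → CondD3 S Pr → ¬ (T ⊢ ConL Pr))
    × (CondC S Pr → CondΣ₁C⁻ S T Pr → ¬ CondRos T Pr)
corollary2p9 S T _ _ _ T-con _ PA⊑T S⊑T Pr Pr-Σ₁ Pr-prov = fromFixedPoint (diagonalLemma (¬̇ Pr))
  where
  -- Taking the pair as an argument keeps θ a variable, so the numeral of its code is not unfolded.
  fromFixedPoint : ∃[ θ ] (PA ⊢ θ ⇔̇ ¬̇ (Pr [ ⌜ θ ⌝ ])) →
    (CondE S T Pr → CondC S Pr → CondD3 S Pr → ¬ (T ⊢ ConL Pr))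
    × (CondC S Pr → CondΣ₁C⁻ S T Pr → ¬ CondRos T Pr)
  fromFixedPoint (θ , p) = ConL-unprovable , ¬Ros
    where open LiarSentence T-con PA⊑T S⊑T Pr-Σ₁ Pr-prov θ (PA⊑T _ p)
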